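{- Up to isomorphism, the unique $2$-anti-transitive critical kernel imperfect digraph of diameter $2$ is $\overrightarrow{A}_3$, the directed cycle of length $3$.
   Context: All digraphs are finite, with no loops and no multiple arcs (a pair of opposite arcs is allowed). A kernel of $D$ is a set $K\subseteq V(D)$ that is independent (no arcs between its vertices) and absorbent (for every $u\in V(D)\setminus K$ there is $v\in K$ with $(u,v)\in A(D)$). $D$ is critical kernel imperfect if $D$ has no kernel but every proper induced subdigraph of $D$ has a kernel. A $k$-path is a directed path (distinct vertices) of length $k$. $D$ is $2$-anti-transitive if for every pair of distinct vertices $u,v$, the existence of a $2$-path from $u$ to $v$ implies $(u,v)\notin A(D)$. The diameter of $D$ is the maximum of the directed distances $d(u,v)$ over all ordered pairs of vertices. -}

module Defs where

open import Data.Fin.Base using (Fin; zero; suc; toℕ; fromℕ; inject₁)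
open import Data.Fin.Subset using (Subset; _∈_; _∉_)
open import Data.Nat.Base using (ℕ; suc; _≤_; _%_)
import Data.Nat.Properties as ℕ
open import Data.Product.Base using (_×_; ∃; ∃₂; ∃-syntax)
open import Data.Vec.Functional using (Vector)
open import Function.Base using (_∘_)
open import Function.Bundles using (_↔_; _↣_; _⇔_; Inverse; Injection)
open import Function.Definitions using (Injective)
open import Level using (0ℓ)
open import Relation.Binary.Core using (Rel)
open import Relation.Binary.Definitions using (Decidable; Irreflexive)
open import Relation.Binary.PropositionalEquality
  using (_≡_; _≢_; refl; cong)
open import Relation.Nullary.Negation using (¬_)

-- Finite digraphs on the vertex set Fin n.  The arcs form a relation, so
-- there are no multiple arcs; only the inhabitation of Arc u v is ever used.
-- Arc u v and Arc v u may hold together.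

record Digraph (n : ℕ) : Set₁ where
  field
    Arc      : Rel (Fin n) 0ℓ
    arc?     : Decidable Arc
    loopless : Irreflexive _≡_ Arc

open Digraph public

record _≅_ {m n : ℕ} (D : Digraph m) (E : Digraph n) : Set where
  field
    bijection : Fin m ↔ Fin n
    arc⇔      : ∀ u v →
                Arc D u v ⇔ Arc E (Inverse.to bijection u) (Inverse.to bijection v)

infix 4 _≅_

module _ {n : ℕ} (D : Digraph n) where

  Independent : Subset n → Set
  Independent K = ∀ {u v} → u ∈ K → v ∈ K → ¬ Arc D u v

  Absorbent : Subset n → Set
  Absorbent K = ∀ {u} → u ∉ K → ∃[ v ] (v ∈ K × Arc D u v)

  IsKernel : Subset n → Set
  IsKernel K = Independent K × Absorbent K

  HasKernel : Set
  HasKernel = ∃ IsKernel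

-- An induced subdigraph is given by an injective enumeration of its vertices;
-- every set of vertices arises as the image of such an enumeration.

induced : ∀ {m n} → Digraph n → Fin m ↣ Fin n → Digraph m
induced D ι = record
  { Arc      = λ i j → Arc D (to i) (to j)
  ; arc?     = λ i j → arc? D (to i) (to j)
  ; loopless = loopless D ∘ cong to
  }
  where open Injection ι using (to)

Proper : ∀ {m n} → Fin m ↣ Fin n → Set
Proper ι = ∃[ v ] (∀ i → Injection.to ι i ≢ v)

CriticalKernelImperfect : ∀ {n} → Digraph n → Set
CriticalKernelImperfect {n} D =
  ¬ HasKernel D ×
  (∀ {m} (ι : Fin m ↣ Fin n) → Proper ι → HasKernel (induced D ι))

-- Directed paths with k arcs, hence k + 1 pairwise distinct vertices.

record Path {n : ℕ} (D : Digraph n) (k : ℕ) (u v : Fin n) : Set where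
  field
    vertex   : Vector (Fin n) (suc k)
    distinct : Injective _≡_ _≡_ vertex
    arcs     : ∀ (i : Fin k) → Arc D (vertex (inject₁ i)) (vertex (suc i))
    source   : vertex zero ≡ u
    target   : vertex (fromℕ k) ≡ v

module _ {n : ℕ} (D : Digraph n) where

  AntiTransitive : ℕ → Set
  AntiTransitive k = ∀ {u v} → u ≢ v → Path D k u v → ¬ Arc D u v

  -- d(u , v) = k, a relation since d(u , v) is infinite when v is not
  -- reachable from u.
  Distance : Fin n → Fin n → ℕ → Set
  Distance u v k = Path D k u v × (∀ {l} → Path D l u v → k ≤ l)

  -- d is the maximum of all the distances, which must in particular be finite.
  HasDiameter : ℕ → Set
  HasDiameter d =
    (∀ u v → ∃[ k ] (Distance u v k × k ≤ d)) ×
    ∃₂ (λ u v → Distance u v d)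

-- The directed cycle 0 → 1 → 2 → 0.

A₃ : Digraph 3
A₃ = record
  { Arc      = λ i j → toℕ j ≡ suc (toℕ i) % 3
  ; arc?     = λ i j → toℕ j ℕ.≟ suc (toℕ i) % 3
  ; loopless = λ { {zero} refl () ; {suc zero} refl () ; {suc (suc zero)} refl () }
  }

{-# OPTIONS --safe #-}
-- Let v be any vertex and K a kernel of D - v.  Since neither K nor K ∪ {v} is
-- a kernel of D, some k ∈ K has k → v but not v → k.  The diameter gives
-- v → w → k, so v, w, k carry a directed triangle, and 2-anti-transitivity
-- excludes all the reverse arcs.  A proper induced subdigraph has a kernel and
-- A₃ has none, so v, w, k are all the vertices of D.
module Submission where

open import Defs
open import Data.Fin.Base using (Fin; punchIn; punchOut)
open import Data.Fin.Patterns using (0F; 1F; 2F)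
open import Data.Fin.Properties
  using (_≟_; all?; any?; toℕ-injective; punchIn-injective; punchIn-punchOut; punchInᵢ≢i)
open import Data.Fin.Subset using (Subset; _∈_)
open import Data.Fin.Subset.Properties using (_∈?_)
open import Data.Nat.Base using (ℕ; zero; suc; z≤n; s≤s)
open import Data.Product.Base using (_×_; _,_; ∃; ∃-syntax)
open import Data.Sum.Base using (_⊎_; inj₁; inj₂)
open import Data.Vec.Base using (tabulate)
open import Data.Vec.Functional using ([]; _∷_)
open import Data.Vec.Properties using (lookup∘tabulate; lookup⇒[]=; []=⇒lookup)
open import Function.Base using (_∘_)
open import Function.Bundles using (_↣_; _⇔_; Equivalence; Injection; mk↣; mk↔ₛ′; mk⇔)
open import Function.Definitions using (Injective)
open import Level using (0ℓ)
open import Relation.Binary.PropositionalEquality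
  using (_≡_; _≢_; refl; sym; trans; subst; subst₂; ≢-sym)
open import Relation.Nullary.Decidable
  using (Dec; yes; no; does; dec-true; from-yes; decidable-stable; ¬?; _×-dec_; _⊎-dec_; _→-dec_)
open import Relation.Nullary.Negation using (¬_; contradiction)
open import Relation.Unary using (Pred; Decidable)

-- Subsets and kernels from decidable predicates.

module _ {n} {P : Pred (Fin n) 0ℓ} (P? : Decidable P) where

  ⟦_⟧ : Subset n
  ⟦_⟧ = tabulate (does ∘ P?)

  ∈⟦⟧⁺ : ∀ {x} → P x → x ∈ ⟦_⟧
  ∈⟦⟧⁺ {x} px = lookup⇒[]= x ⟦_⟧ (trans (lookup∘tabulate _ x) (dec-true (P? x) px))

  ∈⟦⟧⁻ : ∀ {x} → x ∈ ⟦_⟧ → P x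
  -- Abstracting `P? x` also rewrites the equation `does (P? x) ≡ true`, so the `no` case becomes
  -- absurd.
  ∈⟦⟧⁻ {x} x∈ with P? x | trans (sym (lookup∘tabulate (does ∘ P?) x)) ([]=⇒lookup x∈)
  ... | yes px | _  = px
  ... | no _   | ()

module _ {n} (D : Digraph n) where

  kernel-from-predicate : {P : Pred (Fin n) 0ℓ} → Decidable P →
    (∀ {u v} → P u → P v → ¬ Arc D u v) →
    (∀ {u} → ¬ P u → ∃[ v ] (P v × Arc D u v)) →
    HasKernel D
  kernel-from-predicate P? ind abs = ⟦ P? ⟧
    , (λ u∈ v∈ → ind (∈⟦⟧⁻ P? u∈) (∈⟦⟧⁻ P? v∈))
    , λ u∉ → let v , pv , a = abs (u∉ ∘ ∈⟦⟧⁺ P?) in v , ∈⟦⟧⁺ P? pv , a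

kernel-resp-⇔ : ∀ {n} (D E : Digraph n) → (∀ u v → Arc D u v ⇔ Arc E u v) →
                HasKernel D → HasKernel E
kernel-resp-⇔ D E eq (K , ind , abs) = K
  , (λ u∈ v∈ a → ind u∈ v∈ (Equivalence.from (eq _ _) a))
  , λ u∉ → let v , v∈ , a = abs u∉ in v , v∈ , Equivalence.to (eq _ _) a

-- Paths of length at most two and distances.

injective-triple : ∀ {A : Set} {u w v : A} → u ≢ w → w ≢ v → u ≢ v →
                   Injective _≡_ _≡_ (u ∷ w ∷ v ∷ [])
injective-triple p q r {0F} {0F} _ = refl
injective-triple p q r {0F} {1F} e = contradiction e p
injective-triple p q r {0F} {2F} e = contradiction e r
injective-triple p q r {1F} {0F} e = contradiction (sym e) p
injective-triple p q r {1F} {1F} _ = refl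
injective-triple p q r {1F} {2F} e = contradiction e q
injective-triple p q r {2F} {0F} e = contradiction (sym e) r
injective-triple p q r {2F} {1F} e = contradiction (sym e) q
injective-triple p q r {2F} {2F} _ = refl

module _ {n} (D : Digraph n) where

  arc⇒≢ : ∀ {u v} → Arc D u v → u ≢ v
  arc⇒≢ a refl = loopless D refl a

  path₀ : ∀ u → Path D 0 u u
  path₀ u = record
    { vertex = u ∷ [] ; distinct = λ { {0F} {0F} _ → refl } ; arcs = λ ()
    ; source = refl ; target = refl }

  path₁ : ∀ {u v} → Arc D u v → Path D 1 u v
  path₁ {u} {v} a = record
    { vertex   = u ∷ v ∷ []
    ; distinct = λ { {0F} {0F} _ → refl
                   ; {0F} {1F} e → contradiction e (arc⇒≢ a)
                   ; {1F} {0F} e → contradiction (sym e) (arc⇒≢ a)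
                   ; {1F} {1F} _ → refl }
    ; arcs     = λ { 0F → a }
    ; source   = refl ; target = refl }

  path₂ : ∀ {u w v} → u ≢ v → Arc D u w → Arc D w v → Path D 2 u v
  path₂ {u} {w} {v} u≢v a b = record
    { vertex   = u ∷ w ∷ v ∷ []
    ; distinct = injective-triple (arc⇒≢ a) (arc⇒≢ b) u≢v
    ; arcs     = λ { 0F → a ; 1F → b }
    ; source   = refl ; target = refl }

  path₀⇒≡ : ∀ {u v} → Path D 0 u v → u ≡ v
  path₀⇒≡ p = trans (sym (Path.source p)) (Path.target p)

  path₁⇒arc : ∀ {u v} → Path D 1 u v → Arc D u v
  path₁⇒arc p = subst₂ (Arc D) (Path.source p) (Path.target p) (Path.arcs p 0F)

  path₂⇒arcs : ∀ {u v} → Path D 2 u v → ∃[ w ] (Arc D u w × Arc D w v)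
  path₂⇒arcs p = Path.vertex p 1F
    , subst (λ x → Arc D x _) (Path.source p) (Path.arcs p 0F)
    , subst (Arc D _) (Path.target p) (Path.arcs p 1F)

  distance₀ : ∀ u → Distance D u u 0
  distance₀ u = path₀ u , λ _ → z≤n

  distance₁ : ∀ {u v} → Arc D u v → Distance D u v 1
  distance₁ a = path₁ a , λ
    { {zero}  p → contradiction (path₀⇒≡ p) (arc⇒≢ a)
    ; {suc _} p → s≤s z≤n }

  distance₂ : ∀ {u w v} → u ≢ v → ¬ Arc D u v → Arc D u w → Arc D w v → Distance D u v 2
  distance₂ u≢v ¬a b c = path₂ u≢v b c , λ
    { {zero}        p → contradiction (path₀⇒≡ p) u≢v
    ; {suc zero}    p → contradiction (path₁⇒arc p) ¬a
    ; {suc (suc _)} p → s≤s (s≤s z≤n) }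

  diameter₂⇒2-path : HasDiameter D 2 → ∀ {u v} → u ≢ v → ¬ Arc D u v →
                     ∃[ w ] (Arc D u w × Arc D w v)
  diameter₂⇒2-path (dist , _) {u} {v} u≢v ¬a with dist u v
  ... | 0 , (p , _) , _ = contradiction (path₀⇒≡ p) u≢v
  ... | 1 , (p , _) , _ = contradiction (path₁⇒arc p) ¬a
  ... | 2 , (p , _) , _ = path₂⇒arcs p
  ... | suc (suc (suc _)) , _ , s≤s (s≤s ())

-- Properties of the directed triangle.

A₃-functional : ∀ u {v w} → Arc A₃ u v → Arc A₃ u w → v ≡ w
A₃-functional _ a b = toℕ-injective (trans a (sym b))

-- Out-degrees are one, so a shortcut from `u` would end at the middle vertex of the path, and the
-- second arc of the path would be a loop.
A₃-2-antiTransitive : AntiTransitive A₃ 2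
A₃-2-antiTransitive {u} _ p a with path₂⇒arcs A₃ p
... | _ , b , c = arc⇒≢ A₃ c (A₃-functional u b a)

A₃-connects-within-two : ∀ u v → u ≢ v → ¬ Arc A₃ u v → ∃[ w ] (Arc A₃ u w × Arc A₃ w v)
-- The quantifiers range over three vertices, so evaluating the decision procedure is the proof.
A₃-connects-within-two = from-yes (all? λ u → all? λ v →
  ¬? (u ≟ v) →-dec ¬? (arc? A₃ u v) →-dec any? λ w → arc? A₃ u w ×-dec arc? A₃ w v)

A₃-diameter : HasDiameter A₃ 2
A₃-diameter = dist , 0F , 2F , distance₂ A₃ {w = 1F} (λ ()) (λ ()) refl refl
  where
  dist : ∀ u v → ∃[ k ] (Distance A₃ u v k × _)
  dist u v with u ≟ v
  ... | yes refl = 0 , distance₀ A₃ u , z≤n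
  ... | no u≢v with arc? A₃ u v
  ...   | yes a = 1 , distance₁ A₃ a , s≤s z≤n
  ...   | no ¬a = let _ , b , c = A₃-connects-within-two u v u≢v ¬a in
                  2 , distance₂ A₃ u≢v ¬a b c , s≤s (s≤s z≤n)

A₃-successor : ∀ u → ∃[ v ] Arc A₃ u v
A₃-successor = from-yes (all? λ u → any? λ v → arc? A₃ u v)

A₃-closes : ∀ u v w → Arc A₃ u v → Arc A₃ v w → Arc A₃ w u
A₃-closes = from-yes (all? λ u → all? λ v → all? λ w →
  arc? A₃ u v →-dec arc? A₃ v w →-dec arc? A₃ w u)

A₃-2-path-covers : ∀ u v w x → Arc A₃ u v → Arc A₃ v w → u ≢ x → v ≢ x → w ≡ x
A₃-2-path-covers = from-yes (all? λ u → all? λ v → all? λ w → all? λ x →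
  arc? A₃ u v →-dec arc? A₃ v w →-dec ¬? (u ≟ x) →-dec ¬? (v ≟ x) →-dec (w ≟ x))

-- A kernel vertex `u` keeps its successor `v` out of `K`; then `v` needs an out-neighbour `w` in
-- `K`, but `w → u` breaks independence. So `K` is empty and absorbs nothing.
A₃-no-kernel : ¬ HasKernel A₃
A₃-no-kernel (K , ind , abs) = let v , v∈ , _ = abs (∉K 0F) in ∉K v v∈
  where
  ∉K : ∀ u → ¬ (u ∈ K)
  ∉K u u∈ =
    let v , a      = A₃-successor u
        w , w∈ , b = abs (λ v∈ → ind u∈ v∈ a)
    in ind w∈ u∈ (A₃-closes u v w a b)

-- The sinks form a kernel: deleting a vertex of A₃ leaves no path of length 2.
A₃-proper-kernel : ∀ {m} (ι : Fin m ↣ Fin 3) → Proper ι → HasKernel (induced A₃ ι)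
A₃-proper-kernel {m} ι (x , ι≢x) =
  kernel-from-predicate E (λ u → ¬? (nonsink? u)) (λ s _ a → s (_ , a)) absorb
  where
  E : Digraph m
  E = induced A₃ ι

  nonsink? : Decidable (λ u → ∃ (Arc E u))
  nonsink? u = any? (arc? E u)

  absorb : ∀ {u} → ¬ ¬ ∃ (Arc E u) → ∃[ v ] (¬ ∃ (Arc E v) × Arc E u v)
  absorb {u} ¬¬a = let v , a = decidable-stable (nonsink? u) ¬¬a in
    v , (λ { (w , b) → ι≢x w (A₃-2-path-covers _ _ _ x a b (ι≢x u) (ι≢x v)) }) , a

-- Kernels of vertex-deleted subdigraphs.

deletion : ∀ {n} → Fin (suc n) → Fin n ↣ Fin (suc n)
deletion v = mk↣ {to = punchIn v} (punchIn-injective v _ _)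

critical⇒asymmetric-in-arc : ∀ {n} (D : Digraph n) → CriticalKernelImperfect D →
                             ∀ v → ∃[ u ] (Arc D u v × ¬ Arc D v u)
critical⇒asymmetric-in-arc {suc n} D (noKernel , critical) v
  with K , ind , abs ← critical (deletion v) (v , punchInᵢ≢i v) = conclude
  where
  -- `K` lives on the vertices of `D - v`; this is its image among the vertices of `D`, which never
  -- contains `v`.
  InK : Pred (Fin (suc n)) 0ℓ
  InK x = ∃[ i ] (i ∈ K × punchIn v i ≡ x)

  inK? : Decidable InK
  inK? x = any? λ i → (i ∈? K) ×-dec (punchIn v i ≟ x)

  independent : ∀ {x y} → InK x → InK y → ¬ Arc D x y
  independent (_ , i∈ , refl) (_ , j∈ , refl) = ind i∈ j∈

  absorbs-≢v : ∀ {x} → v ≢ x → ¬ InK x → ∃[ y ] (InK y × Arc D x y)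
  absorbs-≢v {x} v≢x x∉ =
    let j , j∈ , a = abs {punchOut v≢x} λ i∈ → x∉ (_ , i∈ , punchIn-punchOut v≢x)
    in punchIn v j , (j , j∈ , refl) , subst (λ z → Arc D z (punchIn v j)) (punchIn-punchOut v≢x) a

  -- Otherwise the image of `K` would absorb `v` too and be a kernel of `D`.
  no-arc-to-K : ∀ {x} → InK x → ¬ Arc D v x
  no-arc-to-K {x} x∈ a = noKernel (kernel-from-predicate D inK? independent absorbs)
    where
    absorbs : ∀ {u} → ¬ InK u → ∃[ w ] (InK w × Arc D u w)
    absorbs {u} u∉ with v ≟ u
    ... | yes refl = x , x∈ , a
    ... | no v≢u   = absorbs-≢v v≢u u∉

  arc-from-K? : Dec (∃[ x ] (InK x × Arc D x v))
  arc-from-K? = any? λ x → inK? x ×-dec arc? D x v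

  conclude : ∃[ u ] (Arc D u v × ¬ Arc D v u)
  conclude with arc-from-K?
  ... | yes (x , x∈ , a) = x , a , no-arc-to-K x∈
  -- With no arcs between `v` and `K` in either direction, adding `v` to `K` keeps it independent,
  -- and `v` no longer needs absorbing.
  ... | no none = contradiction
    (kernel-from-predicate D (λ x → (v ≟ x) ⊎-dec inK? x) indep absorbs) noKernel
    where
    indep : ∀ {x y} → v ≡ x ⊎ InK x → v ≡ y ⊎ InK y → ¬ Arc D x y
    indep (inj₁ refl) (inj₁ refl) a = loopless D refl a
    indep (inj₁ refl) (inj₂ y∈)   a = no-arc-to-K y∈ a
    indep (inj₂ x∈)   (inj₁ refl) a = none (_ , x∈ , a)
    indep (inj₂ x∈)   (inj₂ y∈)   a = independent x∈ y∈ a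

    absorbs : ∀ {x} → ¬ (v ≡ x ⊎ InK x) → ∃[ y ] ((v ≡ y ⊎ InK y) × Arc D x y)
    absorbs x∉ = let y , y∈ , a = absorbs-≢v (x∉ ∘ inj₁) (x∉ ∘ inj₂) in y , inj₂ y∈ , a

-- A directed triangle that exhausts the digraph.

module InducedTriangle {n} (D : Digraph n) (antiTransitive : AntiTransitive D 2)
  {a b c} (ab : Arc D a b) (bc : Arc D b c) (ca : Arc D c a) where

  no-shortcut : ∀ {u w v} → u ≢ v → Arc D u w → Arc D w v → ¬ Arc D u v
  no-shortcut u≢v p q = antiTransitive u≢v (path₂ D u≢v p q)

  a≢c : a ≢ c
  a≢c = ≢-sym (arc⇒≢ D ca)

  triangle : Fin 3 ↣ Fin n
  triangle = mk↣ {to = a ∷ b ∷ c ∷ []} (injective-triple (arc⇒≢ D ab) (arc⇒≢ D bc) a≢c)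

  open Injection triangle using () renaming (to to vertex; injective to vertex-injective)

  -- A reverse arc of the triangle would join the ends of the 2-path formed by the other two arcs.
  arc⇔A₃ : ∀ i j → Arc D (vertex i) (vertex j) ⇔ Arc A₃ i j
  arc⇔A₃ 0F 0F = mk⇔ (λ l → contradiction l (loopless D refl)) λ ()
  arc⇔A₃ 0F 1F = mk⇔ (λ _ → refl) λ _ → ab
  arc⇔A₃ 0F 2F = mk⇔ (λ l → contradiction l (no-shortcut a≢c ab bc)) λ ()
  arc⇔A₃ 1F 0F = mk⇔ (λ l → contradiction l (no-shortcut (≢-sym (arc⇒≢ D ab)) bc ca)) λ ()
  arc⇔A₃ 1F 1F = mk⇔ (λ l → contradiction l (loopless D refl)) λ ()
  arc⇔A₃ 1F 2F = mk⇔ (λ _ → refl) λ _ → bc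
  arc⇔A₃ 2F 0F = mk⇔ (λ _ → refl) λ _ → ca
  arc⇔A₃ 2F 1F = mk⇔ (λ l → contradiction l (no-shortcut (≢-sym (arc⇒≢ D bc)) ca ab)) λ ()
  arc⇔A₃ 2F 2F = mk⇔ (λ l → contradiction l (loopless D refl)) λ ()

  no-kernel : ¬ HasKernel (induced D triangle)
  no-kernel = A₃-no-kernel ∘ kernel-resp-⇔ (induced D triangle) A₃ arc⇔A₃

  critical⇒≅A₃ : CriticalKernelImperfect D → D ≅ A₃
  critical⇒≅A₃ (_ , critical) = record
    -- One inverse law is the choice of `index`; the other follows from it by injectivity of
    -- `vertex`.
    { bijection = mk↔ₛ′ index vertex (λ i → vertex-injective (vertex-index (vertex i))) vertex-index
    ; arc⇔      = λ u v → subst₂ (λ x y → Arc D x y ⇔ Arc A₃ (index u) (index v))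
                            (vertex-index u) (vertex-index v) (arc⇔A₃ (index u) (index v))
    }
    where
    covers : ∀ v → ∃[ i ] vertex i ≡ v
    -- A missed vertex would make the triangle a proper induced subdigraph, to which criticality
    -- gives a kernel.
    covers v = decidable-stable (any? λ i → vertex i ≟ v)
      λ missed → no-kernel (critical triangle (v , λ i e → missed (i , e)))

    index : Fin n → Fin 3
    index v = let i , _ = covers v in i

    vertex-index : ∀ v → vertex (index v) ≡ v
    vertex-index v = let _ , e = covers v in e

theorem28 : (AntiTransitive A₃ 2 × CriticalKernelImperfect A₃ × HasDiameter A₃ 2) ×
    (∀ (n : ℕ) (D : Digraph n) →
    AntiTransitive D 2 → CriticalKernelImperfect D → HasDiameter D 2 →
    D ≅ A₃)
theorem28 = (A₃-2-antiTransitive , (A₃-no-kernel , A₃-proper-kernel) , A₃-diameter) , unique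
  where
  unique : ∀ n (D : Digraph n) → AntiTransitive D 2 → CriticalKernelImperfect D →
           HasDiameter D 2 → D ≅ A₃
  -- The pair attaining the diameter supplies a vertex `v` to start from.
  unique n D antiTransitive critical diameter@(_ , v , _) =
    let k , kv , ¬vk = critical⇒asymmetric-in-arc D critical v
        w , vw , wk  = diameter₂⇒2-path D diameter (≢-sym (arc⇒≢ D kv)) ¬vk
    in InducedTriangle.critical⇒≅A₃ D antiTransitive vw wk kv critical
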